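{- Let $k\geq 2$ be an integer. 1. Denote by $f_k(n)$ the number of words over $k$ of length $n$ that avoid the pattern $z,z+1,z$. Then, for $n\geq 3$, the numbers $f_k(n)$ satisfy the recursion \[f_k(n)=kf_k(n-1)-f_k(n-2)+f_k(n-3),\] with initial values $f_k(0)=1$, $f_k(1)=k$, and $f_k(2)=k^2$. In particular, the corresponding generating function $\sum_{n\geq 0}f_k(n)x^n$ is given by \[\frac{1+x^2}{1-kx+x^2-x^3}.\] 2. Denote by $g_k(n)$ the number of words over $k$ of length $n$ that avoid the pattern $z,z,z+1$. Then, for $n\geq 2k-1$, the numbers $g_k(n)$ satisfy the recursion \[g_k(n)=\sum_{i=0}^{k-1}(-1)^i(k-i)\,g_k(n-2i-1).\] Furthermore, the corresponding generating function $\sum_{n\geq 0}g_k(n)x^n$ is given by \[\frac{1}{1-\sum_{i=0}^{k-1}(-1)^i(k-i)x^{2i+1}}.\]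
   Context: For an integer $k\geq 2$ let $[k]=\{1,2,\ldots,k\}$. For a nonnegative integer $n$, a word over $k$ of length $n$ is an element of $[k]^n$ (there is exactly one word of length $0$). A word $w_1\cdots w_n\in[k]^n$ avoids the pattern $z,z+1,z$ if there are no $1\leq i\leq n-2$ and $z\in[k]$ such that $w_i=z$, $w_{i+1}=z+1$ and $w_{i+2}=z$. It avoids the pattern $z,z,z+1$ if there are no $1\leq i\leq n-2$ and $z\in[k]$ such that $w_i=z$, $w_{i+1}=z$ and $w_{i+2}=z+1$. -}

module Defs where

open import Data.Nat as ℕ using (ℕ; zero; suc; _∸_)
open import Data.Integer using (ℤ; +_; _+_; _-_; _*_; 0ℤ; 1ℤ)
open import Data.Integer.Properties using (+-0-monoid)
open import Data.Fin using (Fin; toℕ)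
open import Data.Fin.Properties using (any?) renaming (_≟_ to _≟ᶠ_)
open import Data.List using (List; []; _∷_; length; filter; allFin; cartesianProductWith)
open import Data.List.Membership.Propositional using (_∈_)
open import Data.List.Membership.Propositional.Properties
  using (∈-allFin; ∈-cartesianProductWith⁺)
open import Data.List.Relation.Unary.All using ([])
open import Data.List.Relation.Unary.AllPairs using ([]; _∷_)
open import Data.List.Relation.Unary.Any using (here)
open import Data.List.Relation.Unary.Unique.Propositional using (Unique)
open import Data.List.Relation.Unary.Unique.Propositional.Properties
  using (allFin⁺; cartesianProductWith⁺)
open import Data.Product using (∃-syntax; Σ-syntax; _×_)
open import Data.Vec using (Vec; []; _∷_; lookup)
open import Data.Vec.Properties using (∷-injective)
open import Relation.Binary.PropositionalEquality using (_≡_; _≗_; refl)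
open import Relation.Nullary using (Dec; ¬_; ¬?; _×-dec_)
open import Relation.Unary using (Decidable)

open import Algebra.Properties.Monoid.Sum +-0-monoid public using (sum-syntax)

-- The alphabet {1, …, k} is represented by Fin k, i.e. letters are shifted
-- to {0, …, k-1}; the patterns only involve differences of letters.
Word : ℕ → ℕ → Set
Word k n = Vec (Fin k) n

words : ∀ k n → List (Word k n)
words k zero    = [] ∷ []
words k (suc n) = cartesianProductWith _∷_ (allFin k) (words k n)

words-complete : ∀ {k n} (w : Word k n) → w ∈ words k n
words-complete []      = here refl
words-complete (a ∷ w) = ∈-cartesianProductWith⁺ _∷_ (∈-allFin a) (words-complete w)

words-unique : ∀ k n → Unique (words k n)
words-unique k zero    = [] ∷ []
words-unique k (suc n) =
  cartesianProductWith⁺ _∷_ ∷-injective (allFin⁺ k) (words-unique k n)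

-- b is the letter (or position) a + 1; in particular a + 1 must exist in Fin m.
_IsSucOf_ : ∀ {m} → Fin m → Fin m → Set
b IsSucOf a = toℕ b ≡ suc (toℕ a)

-- h, i, j are consecutive positions of w carrying z, z+1, z.
Contains-z,z+1,z : ∀ {k n} → Word k n → Set
Contains-z,z+1,z w =
  ∃[ h ] ∃[ i ] ∃[ j ] i IsSucOf h × j IsSucOf i ×
    (∃[ z ] lookup w h ≡ z × lookup w i IsSucOf z × lookup w j ≡ z)

-- h, i, j are consecutive positions of w carrying z, z, z+1.
Contains-z,z,z+1 : ∀ {k n} → Word k n → Set
Contains-z,z,z+1 w =
  ∃[ h ] ∃[ i ] ∃[ j ] i IsSucOf h × j IsSucOf i ×
    (∃[ z ] lookup w h ≡ z × lookup w i ≡ z × lookup w j IsSucOf z)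

Avoids-z,z+1,z Avoids-z,z,z+1 : ∀ {k n} → Word k n → Set
Avoids-z,z+1,z w = ¬ Contains-z,z+1,z w
Avoids-z,z,z+1 w = ¬ Contains-z,z,z+1 w

isSucOf? : ∀ {m} (b a : Fin m) → Dec (b IsSucOf a)
isSucOf? b a = toℕ b ℕ.≟ suc (toℕ a)

avoids-z,z+1,z? : ∀ {k n} → Decidable (Avoids-z,z+1,z {k} {n})
avoids-z,z+1,z? w = ¬? (any? λ h → any? λ i → any? λ j →
  isSucOf? i h ×-dec isSucOf? j i ×-dec
  any? λ z → lookup w h ≟ᶠ z ×-dec isSucOf? (lookup w i) z ×-dec lookup w j ≟ᶠ z)

avoids-z,z,z+1? : ∀ {k n} → Decidable (Avoids-z,z,z+1 {k} {n})
avoids-z,z,z+1? w = ¬? (any? λ h → any? λ i → any? λ j →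
  isSucOf? i h ×-dec isSucOf? j i ×-dec
  any? λ z → lookup w h ≟ᶠ z ×-dec lookup w i ≟ᶠ z ×-dec isSucOf? (lookup w j) z)

f g : ℕ → ℕ → ℕ
f k n = length (filter avoids-z,z+1,z? (words k n))
g k n = length (filter avoids-z,z,z+1? (words k n))

-- Formal power series over ℤ as coefficient sequences, compared by _≗_.
Series : Set
Series = ℕ → ℤ

infixl 6 _⊕_ _⊖_
infixl 7 _⊛_
infix  8 _·X^_

_⊕_ _⊖_ _⊛_ : Series → Series → Series
(A ⊕ B) n = A n + B n
(A ⊖ B) n = A n - B n
(A ⊛ B) n = ∑[ i < suc n ] (A (toℕ i) * B (n ∸ toℕ i))

_·X^_ : ℤ → ℕ → Series
(c ·X^ zero)  zero    = c
(c ·X^ zero)  (suc n) = 0ℤ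
(c ·X^ suc m) zero    = 0ℤ
(c ·X^ suc m) (suc n) = (c ·X^ m) n

one : Series
one = 1ℤ ·X^ 0

∑ˢ : ∀ m → (Fin m → Series) → Series
∑ˢ m A n = ∑[ i < m ] (A i n)

-- F = P / Q in ℤ[[x]]: Q is invertible and F = P Q⁻¹.
_≐_/_ : Series → Series → Series → Set
F ≐ P / Q = Σ[ Q⁻¹ ∈ Series ] (Q ⊛ Q⁻¹ ≗ one) × (F ≗ P ⊛ Q⁻¹)

-- The ordinary generating function of a.
genFun : (ℕ → ℕ) → Series
genFun a n = + a n

{-# OPTIONS --safe #-}

-- Let N(n) count the avoiding words of length n and N_a(n) those whose first
-- letter is a. Each pattern is an occurrence a b c in which a determines b and
-- c, and b c cannot start another occurrence. Prepending a to an avoiding word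
-- therefore fails only for the words b ∷ u with u avoiding and starting with c:
--   N_a(n + 2) = N(n + 1) − N_c(n),
-- without the last term if a is the largest letter. For z, z+1, z we have c = a
-- and summing over a gives the recursion. For z, z, z+1 we have c = a + 1, and
-- iterating over the alphabet gives the alternating sum.

module Submission where

open import Defs
open import Data.Nat as ℕ using (ℕ; zero; suc; _≤_; _∸_; z≤n; s≤s)
open import Data.Integer using (ℤ; +_; -_; _+_; _-_; _*_; _^_; 0ℤ; 1ℤ; -1ℤ)
import Data.Integer.Properties as ℤ
open import Data.Integer.Tactic.RingSolver using (solve-∀)
open import Data.Fin using (Fin; zero; suc; toℕ; fromℕ; inject₁)
open import Data.List using
  (List; []; _∷_; length; filter; map; _++_; tabulate; cartesianProductWith)
import Data.List.Properties as List
import Data.Nat.Properties as ℕ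
import Data.Fin.Properties as Fin
open import Data.Product using (_×_; _,_; ∃-syntax; proj₁; proj₂)
open import Data.Sum using (_⊎_; inj₁; inj₂; [_,_])
open import Data.Empty using (⊥; ⊥-elim)
open import Data.Vec using ([]; _∷_; lookup)
open import Function using (_∘_; id; _⇔_; mk⇔)
open import Function.Bundles using (Equivalence)
open import Relation.Binary.PropositionalEquality using
  (_≡_; _≢_; _≗_; refl; sym; trans; cong; cong₂; subst; module ≡-Reasoning)
open import Relation.Nullary using (Dec; yes; no; ¬_; ¬?; _×-dec_)
open import Relation.Unary using (Decidable)
import Algebra.Properties.Semiring.Sum as Sum
open Sum ℤ.+-*-semiring using
  (sum-cong-≗; sum-init-last; ∑-distrib-+; ∑-comm; *-distribʳ-sum; sum-replicate-zero)
open ≡-Reasoning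

-- Counting the elements of a list that satisfy a decidable predicate

module _ {A : Set} {P : A → Set} where
  # : Decidable P → List A → ℤ
  # P? xs = + length (filter P? xs)

  #-++ : (P? : Decidable P) → ∀ xs ys → # P? (xs ++ ys) ≡ # P? xs + # P? ys
  #-++ P? xs ys = begin
    + length (filter P? (xs ++ ys))
      ≡⟨ cong (+_ ∘ length) (List.filter-++ P? xs ys) ⟩
    + length (filter P? xs ++ filter P? ys)
      ≡⟨ cong +_ (List.length-++ (filter P? xs)) ⟩
    + (length (filter P? xs) ℕ.+ length (filter P? ys))
      ≡⟨ ℤ.pos-+ (length (filter P? xs)) _ ⟩
    # P? xs + # P? ys ∎

  #-none : (P? : Decidable P) → (∀ x → ¬ P x) → ∀ xs → # P? xs ≡ 0ℤ
  #-none P? ¬P []       = refl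
  #-none P? ¬P (x ∷ xs) with P? x
  ... | yes p = ⊥-elim (¬P x p)
  ... | no  _ = #-none P? ¬P xs

#-cong : {A : Set} {P Q : A → Set} (P? : Decidable P) (Q? : Decidable Q) →
         (∀ x → P x ⇔ Q x) → ∀ xs → # P? xs ≡ # Q? xs
#-cong P? Q? P⇔Q xs = cong (+_ ∘ length) (List.filter-≐ P? Q?
  ((λ {x} → Equivalence.to (P⇔Q x)) , (λ {x} → Equivalence.from (P⇔Q x))) xs)

#-split : {A : Set} {P Q : A → Set} (P? : Decidable P) (Q? : Decidable Q) → ∀ xs →
          # P? xs ≡ # (λ x → P? x ×-dec ¬? (Q? x)) xs + # (λ x → P? x ×-dec Q? x) xs
#-split P? Q? []       = refl
#-split P? Q? (x ∷ xs) with P? x | Q? x | #-split P? Q? xs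
... | no  _ | _     | ih = ih
... | yes _ | no  _ | ih = cong (λ y → 1ℤ + y) ih
... | yes _ | yes _ | ih = trans (cong (λ y → 1ℤ + y) ih)
  (cong +_ (sym (ℕ.+-suc (length (filter (λ x → P? x ×-dec ¬? (Q? x)) xs)) _)))

#-map : ∀ {A B : Set} {P : B → Set} (P? : Decidable P) (h : A → B) → ∀ xs →
        # P? (map h xs) ≡ # (P? ∘ h) xs
#-map P? h []       = refl
#-map P? h (x ∷ xs) with P? (h x)
... | yes _ = cong (λ y → 1ℤ + y) (#-map P? h xs)
... | no  _ = #-map P? h xs

#-cartesianProductWith :
  ∀ {A B C : Set} {P : C → Set} (P? : Decidable P) (h : A → B → C) →
  ∀ {m} (t : Fin m → A) ys →
  # P? (cartesianProductWith h (tabulate t) ys) ≡ ∑[ i < m ] # (P? ∘ h (t i)) ys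
#-cartesianProductWith P? h {zero}  t ys = refl
#-cartesianProductWith P? h {suc m} t ys =
  trans (#-++ P? (map (h (t zero)) ys) _)
        (cong₂ _+_ (#-map P? (h (t zero)) ys) (#-cartesianProductWith P? h (t ∘ suc) ys))

#-words : ∀ {k n} {P : Word k (suc n) → Set} (P? : Decidable P) →
          # P? (words k (suc n)) ≡ ∑[ a < k ] # (P? ∘ (a ∷_)) (words k n)
#-words {k} {n} P? = #-cartesianProductWith P? _∷_ id (words k n)

-- Finite sums of integers

∑-zero : ∀ {m} (t : Fin m → ℤ) → (∀ i → t i ≡ 0ℤ) → ∑[ i < m ] t i ≡ 0ℤ
∑-zero {m} t t≡0 = trans (sum-cong-≗ t≡0) (sum-replicate-zero m)

∑-single : ∀ {m} (t : Fin m → ℤ) b → (∀ i → i ≢ b → t i ≡ 0ℤ) →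
            ∑[ i < m ] t i ≡ t b
∑-single t zero    t≡0 =
  trans (cong (λ y → t zero + y) (∑-zero (t ∘ suc) (λ i → t≡0 (suc i) λ ())))
        (ℤ.+-identityʳ (t zero))
∑-single t (suc b) t≡0 =
  trans (cong₂ _+_ (t≡0 zero λ ())
                   (∑-single (t ∘ suc) b λ i i≢b → t≡0 (suc i) (i≢b ∘ Fin.suc-injective)))
        (ℤ.+-identityˡ (t (suc b)))

∑-const-minus : ∀ m c (t : Fin m → ℤ) →
                ∑[ i < m ] (c - t i) ≡ + m * c - ∑[ i < m ] t i
∑-const-minus zero    c t = refl
∑-const-minus (suc m) c t = begin
  c - t zero + ∑[ i < m ] (c - t (suc i))
    ≡⟨ cong (λ y → c - t zero + y) (∑-const-minus m c (t ∘ suc)) ⟩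
  c - t zero + (+ m * c - ∑[ i < m ] t (suc i))
    ≡⟨ lemma c (+ m) (t zero) _ ⟩
  (1ℤ + + m) * c - (t zero + ∑[ i < m ] t (suc i)) ∎
  where
  lemma : ∀ c m x y → c - x + (m * c - y) ≡ (1ℤ + m) * c - (x + y)
  lemma = solve-∀

∑-const : ∀ m c → ∑[ i < m ] c ≡ + m * c
∑-const zero    c = refl
∑-const (suc m) c = trans (cong (λ y → c + y) (∑-const m c)) (sym (ℤ.suc-* (+ m) c))

∑-distrib-- : ∀ {m} (s t : Fin m → ℤ) →
              ∑[ i < m ] (s i - t i) ≡ ∑[ i < m ] s i - ∑[ i < m ] t i
∑-distrib-- {zero}  s t = refl
∑-distrib-- {suc m} s t =
  trans (cong (λ y → s zero - t zero + y) (∑-distrib-- (s ∘ suc) (t ∘ suc)))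
        (lemma (s zero) (t zero) _ _)
  where
  lemma : ∀ a b c d → a - b + (c - d) ≡ a + c - (b + d)
  lemma = solve-∀

-- Patterns of three consecutive letters

module Avoidance {k : ℕ}
  (R : Fin k → Fin k → Fin k → Set) (R? : ∀ a b c → Dec (R a b c))
  (no-overlap : ∀ {a b c d} → R a b c → ¬ R b c d) where

  -- Once `R` is instantiated by an existential over z, this unfolds to the containment predicate
  -- used by `f` or `g`, so their decision procedures apply without conversion.
  Contains : ∀ {n} → Word k n → Set
  Contains w = ∃[ h ] ∃[ i ] ∃[ j ] i IsSucOf h × j IsSucOf i ×
    R (lookup w h) (lookup w i) (lookup w j)

  Avoids : ∀ {n} → Word k n → Set
  Avoids w = ¬ Contains w

  -- The word a ∷ w starts with an occurrence of R.
  Starts : Fin k → ∀ {n} → Word k n → Set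
  Starts a []          = ⊥
  Starts a (b ∷ [])    = ⊥
  Starts a (b ∷ c ∷ _) = R a b c

  starts? : ∀ a {n} → Decidable (Starts a {n})
  starts? a []          = no λ ()
  starts? a (b ∷ [])    = no λ ()
  starts? a (b ∷ c ∷ _) = R? a b c

  HeadIs : Fin k → ∀ {n} → Word k n → Set
  HeadIs a []      = ⊥
  HeadIs a (b ∷ _) = b ≡ a

  headIs? : ∀ a {n} → Decidable (HeadIs a {n})
  headIs? a []      = no λ ()
  headIs? a (b ∷ _) = b Fin.≟ a

  contains-∷⁻ : ∀ {n a} (w : Word k n) → Contains (a ∷ w) → Starts a w ⊎ Contains w
  contains-∷⁻ (_ ∷ _ ∷ _) (zero , suc zero , suc (suc zero) , _ , _ , r) = inj₁ r
  contains-∷⁻ (_ ∷ [])    (zero , suc zero , suc (suc ()) , _ , _ , r)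
  contains-∷⁻ w (zero , suc zero , suc zero , _ , () , _)
  contains-∷⁻ w (zero , suc zero , zero , _ , () , _)
  contains-∷⁻ w (suc h , suc i , suc j , p , q , r) =
    inj₂ (h , i , j , ℕ.suc-injective p , ℕ.suc-injective q , r)

  contains-starts : ∀ {n a} (w : Word k n) → Starts a w → Contains (a ∷ w)
  contains-starts (_ ∷ _ ∷ _) r = zero , suc zero , suc (suc zero) , refl , refl , r

  contains-∷⁺ : ∀ {n a} (w : Word k n) → Contains w → Contains (a ∷ w)
  contains-∷⁺ w (h , i , j , p , q , r) = suc h , suc i , suc j , cong suc p , cong suc q , r

  avoids-∷ : ∀ {n a} (w : Word k n) → Avoids (a ∷ w) ⇔ (Avoids w × ¬ Starts a w)
  avoids-∷ w = mk⇔ (λ av → av ∘ contains-∷⁺ w , av ∘ contains-starts w)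
                   (λ (av , ¬s) c → [ ¬s , av ] (contains-∷⁻ w c))

  module Counting (avoids? : ∀ {n} → Decidable (Avoids {n})) where

    -- With the decision procedures behind `f` and `g`, `N n` is `+ f k n` or `+ g k n` by
    -- definition. Integer values allow the counts to be subtracted.
    N : ℕ → ℤ
    N n = # avoids? (words k n)

    -- Indexed by the full length of the word, so that it also makes sense, with value 0, for the
    -- empty word; the recursions reach down to that case.
    N-head : Fin k → ℕ → ℤ
    N-head a n = # (λ w → avoids? w ×-dec headIs? a w) (words k n)

    N-0 : N 0 ≡ 1ℤ
    N-0 with avoids? []
    ... | yes _  = refl
    ... | no ¬av = ⊥-elim (¬av λ ())

    N-head-0 : ∀ a → N-head a 0 ≡ 0ℤ
    N-head-0 a = #-none (λ w → avoids? w ×-dec headIs? a w) (λ { [] () }) (words k 0)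

    N-head-∷ : ∀ a n → N-head a (suc n) ≡ # (avoids? ∘ (a ∷_)) (words k n)
    N-head-∷ a n = begin
      N-head a (suc n)
        ≡⟨ #-words (λ w → avoids? w ×-dec headIs? a w) ⟩
      ∑[ b < k ] # (λ w → avoids? (b ∷ w) ×-dec b Fin.≟ a) (words k n)
        ≡⟨ ∑-single _ a (λ b b≢a → #-none _ (λ _ → b≢a ∘ proj₂) (words k n)) ⟩
      # (λ w → avoids? (a ∷ w) ×-dec a Fin.≟ a) (words k n)
        ≡⟨ #-cong _ _ (λ _ → mk⇔ proj₁ (_, refl)) (words k n) ⟩
      # (avoids? ∘ (a ∷_)) (words k n) ∎

    N-suc : ∀ n → N (suc n) ≡ ∑[ a < k ] N-head a (suc n)
    N-suc n = trans (#-words avoids?)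
                    (sum-cong-≗ λ a → sym (N-head-∷ a n))

    N-starts : Fin k → ℕ → ℤ
    N-starts a n = # (λ w → avoids? w ×-dec starts? a w) (words k n)

    -- Prepending `a` to an avoiding word fails exactly when it creates an occurrence at the front,
    -- so these failures are subtracted from all avoiding words.
    N-head-suc : ∀ a n → N-head a (suc n) ≡ N n - N-starts a n
    N-head-suc a n = begin
      N-head a (suc n)
        ≡⟨ N-head-∷ a n ⟩
      # (avoids? ∘ (a ∷_)) (words k n)
        ≡⟨ #-cong _ _ avoids-∷ (words k n) ⟩
      x
        ≡⟨ lemma x (N-starts a n) ⟩
      x + N-starts a n - N-starts a n
        ≡⟨ cong (_- N-starts a n) (#-split avoids? (starts? a) (words k n)) ⟨
      N n - N-starts a n ∎
      where
      x = # (λ w → avoids? w ×-dec ¬? (starts? a w)) (words k n)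
      lemma : ∀ x y → x ≡ x + y - y
      lemma = solve-∀

    N-head-1 : ∀ a → N-head a 1 ≡ N 0
    N-head-1 a = begin
      N-head a 1
        ≡⟨ N-head-suc a 0 ⟩
      N 0 - N-starts a 0
        ≡⟨ cong (λ y → N 0 - y) (#-none (λ w → avoids? w ×-dec starts? a w) (λ { [] () }) (words k 0)) ⟩
      N 0 - 0ℤ
        ≡⟨ ℤ.+-identityʳ (N 0) ⟩
      N 0 ∎

    -- Meant for the largest letter, which starts no occurrence because it has no successor.
    N-head-free : ∀ a → (∀ x y → ¬ R a x y) → ∀ n → N-head a (suc n) ≡ N n
    N-head-free a ¬R n = begin
      N-head a (suc n)
        ≡⟨ N-head-suc a n ⟩
      N n - N-starts a n
        ≡⟨ cong (λ y → N n - y) (#-none _ (λ w → ¬starts w ∘ proj₂) (words k n)) ⟩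
      N n - 0ℤ
        ≡⟨ ℤ.+-identityʳ (N n) ⟩
      N n ∎
      where
      ¬starts : ∀ {n} (w : Word k n) → ¬ Starts a w
      ¬starts (_ ∷ _ ∷ _) = ¬R _ _

    -- The words to which `a` cannot be prepended have the form `b ∷ w` with `w` starting with `c`.
    -- Conversely, if `w` avoids `R` and starts with `c`, then so does `b ∷ w` avoid `R`: an
    -- occurrence at its front would overlap a b c, which `no-overlap` excludes.
    N-head-pattern : ∀ a b c → (∀ x y → R a x y ⇔ (x ≡ b × y ≡ c)) →
                     ∀ n → N-head a (suc (suc n)) ≡ N (suc n) - N-head c n
    N-head-pattern a b c R⇔ n = trans (N-head-suc a (suc n)) (cong (λ y → N (suc n) - y) (begin
      N-starts a (suc n)
        ≡⟨ #-words (λ w → avoids? w ×-dec starts? a w) ⟩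
      ∑[ x < k ] # (λ w → avoids? (x ∷ w) ×-dec starts? a (x ∷ w)) (words k n)
        ≡⟨ ∑-single _ b (λ x x≢b → #-none _ (λ w → x≢b ∘ starts-head w ∘ proj₂) (words k n)) ⟩
      # (λ w → avoids? (b ∷ w) ×-dec starts? a (b ∷ w)) (words k n)
        ≡⟨ #-cong _ _ (λ w → mk⇔ (to w) (from w)) (words k n) ⟩
      N-head c n ∎))
      where
      Rabc : R a b c
      Rabc = Equivalence.from (R⇔ b c) (refl , refl)
      starts-head : ∀ {n x} (w : Word k n) → Starts a (x ∷ w) → x ≡ b
      starts-head (_ ∷ _) = proj₁ ∘ Equivalence.to (R⇔ _ _)
      to : ∀ {n} (w : Word k n) →
           Avoids (b ∷ w) × Starts a (b ∷ w) → Avoids w × HeadIs c w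
      to w@(_ ∷ _) (av , s) = av ∘ contains-∷⁺ w , proj₂ (Equivalence.to (R⇔ _ _) s)
      from : ∀ {n} (w : Word k n) →
             Avoids w × HeadIs c w → Avoids (b ∷ w) × Starts a (b ∷ w)
      from w@(_ ∷ w′) (av , refl) = Equivalence.from (avoids-∷ w) (av , ¬starts w′) , Rabc
        where
        ¬starts : ∀ {n} (w : Word k n) → ¬ Starts b (c ∷ w)
        ¬starts (_ ∷ _) = no-overlap Rabc

-- Formal power series

·X^0-⊛ : ∀ c H n → (c ·X^ 0 ⊛ H) n ≡ c * H n
·X^0-⊛ c H n =
  -- All summands of the convolution after the first reduce to `0ℤ`.
  trans (cong (λ y → c * H n + y) (sum-replicate-zero n)) (ℤ.+-identityʳ (c * H n))

one-⊛ : ∀ H → one ⊛ H ≗ H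
one-⊛ H n = trans (·X^0-⊛ 1ℤ H n) (ℤ.*-identityˡ (H n))

-- The summand at index 0 reduces to `0ℤ`, and the remaining ones are by computation those of the
-- unshifted product.
·X^suc-⊛ : ∀ c m H n → (c ·X^ suc m ⊛ H) (suc n) ≡ (c ·X^ m ⊛ H) n
·X^suc-⊛ c m H n = ℤ.+-identityˡ _

·X^-⊛ : ∀ c m H n → (c ·X^ m ⊛ H) (m ℕ.+ n) ≡ c * H n
·X^-⊛ c zero    H n = ·X^0-⊛ c H n
·X^-⊛ c (suc m) H n = trans (·X^suc-⊛ c m H (m ℕ.+ n)) (·X^-⊛ c m H n)

·X^-⊛-≤ : ∀ c {m n} H → m ≤ n → (c ·X^ m ⊛ H) n ≡ c * H (n ∸ m)
·X^-⊛-≤ c {m} {n} H m≤n =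
  trans (cong (c ·X^ m ⊛ H) (sym (ℕ.m+[n∸m]≡n m≤n))) (·X^-⊛ c m H (n ∸ m))

⊛-distribʳ-⊕ : ∀ A B H n → ((A ⊕ B) ⊛ H) n ≡ (A ⊛ H) n + (B ⊛ H) n
⊛-distribʳ-⊕ A B H n = trans
  (sum-cong-≗ {suc n} λ i → ℤ.*-distribʳ-+ (H (n ∸ toℕ i)) (A (toℕ i)) (B (toℕ i)))
  (∑-distrib-+ {suc n} (λ i → A (toℕ i) * H (n ∸ toℕ i))
                       (λ i → B (toℕ i) * H (n ∸ toℕ i)))

⊛-distribʳ-⊖ : ∀ A B H n → ((A ⊖ B) ⊛ H) n ≡ (A ⊛ H) n - (B ⊛ H) n
⊛-distribʳ-⊖ A B H n = trans
  (sum-cong-≗ {suc n} λ i → lemma (A (toℕ i)) (B (toℕ i)) (H (n ∸ toℕ i)))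
  (∑-distrib-- {suc n} (λ i → A (toℕ i) * H (n ∸ toℕ i))
                       (λ i → B (toℕ i) * H (n ∸ toℕ i)))
  where
  lemma : ∀ a b h → (a - b) * h ≡ a * h - b * h
  lemma = solve-∀

-- Distribute the factor over the inner sum, then exchange the two sums.
⊛-distribʳ-∑ˢ : ∀ m (A : Fin m → Series) H n →
                (∑ˢ m A ⊛ H) n ≡ ∑[ i < m ] (A i ⊛ H) n
⊛-distribʳ-∑ˢ m A H n = trans
  (sum-cong-≗ {suc n} λ j → *-distribʳ-sum {m} (H (n ∸ toℕ j)) (λ i → A i (toℕ j)))
  (∑-comm {suc n} {m} (λ j i → A i (toℕ j) * H (n ∸ toℕ j)))

·X^-⊛-< : ∀ c {m n} H → n ℕ.< m → (c ·X^ m ⊛ H) n ≡ 0ℤ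
·X^-⊛-< c {suc m} {zero}  H n<m       = refl
·X^-⊛-< c {suc m} {suc n} H (s≤s n<m) = trans (·X^suc-⊛ c m H n) (·X^-⊛-< c H n<m)

neg-·X^-⊛ : ∀ c m H n → ((- c) ·X^ m ⊛ H) n ≡ - (c ·X^ m ⊛ H) n
neg-·X^-⊛ c zero    H n       = begin
  ((- c) ·X^ 0 ⊛ H) n ≡⟨ ·X^0-⊛ (- c) H n ⟩
  - c * H n           ≡⟨ ℤ.neg-distribˡ-* c (H n) ⟨
  - (c * H n)         ≡⟨ cong -_ (·X^0-⊛ c H n) ⟨
  - (c ·X^ 0 ⊛ H) n   ∎
neg-·X^-⊛ c (suc m) H zero    = refl
neg-·X^-⊛ c (suc m) H (suc n) = begin
  ((- c) ·X^ suc m ⊛ H) (suc n) ≡⟨ ·X^suc-⊛ (- c) m H n ⟩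
  ((- c) ·X^ m ⊛ H) n           ≡⟨ neg-·X^-⊛ c m H n ⟩
  - (c ·X^ m ⊛ H) n             ≡⟨ cong -_ (·X^suc-⊛ c m H n) ⟨
  - (c ·X^ suc m ⊛ H) (suc n)   ∎

-- The pattern z, z+1, z

module RationalInverse (κ : ℤ) where

  -- The coefficients of `Q⁻¹` come from solving Q Q⁻¹ = 1 degree by degree; the first three values
  -- are the recursion with 0 at negative indices.
  Q Q⁻¹ : Series
  Q = one ⊖ κ ·X^ 1 ⊕ 1ℤ ·X^ 2 ⊖ 1ℤ ·X^ 3

  Q⁻¹ 0 = 1ℤ
  Q⁻¹ 1 = κ
  Q⁻¹ 2 = κ * κ - 1ℤ
  Q⁻¹ (suc (suc (suc n))) = κ * Q⁻¹ (suc (suc n)) - Q⁻¹ (suc n) + Q⁻¹ n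

  -- The monomial products enter through equations, so that each degree can supply them already
  -- evaluated.
  Q-⊛ : ∀ n {x y z} → (κ ·X^ 1 ⊛ Q⁻¹) n ≡ x →
        (1ℤ ·X^ 2 ⊛ Q⁻¹) n ≡ y → (1ℤ ·X^ 3 ⊛ Q⁻¹) n ≡ z →
        (Q ⊛ Q⁻¹) n ≡ Q⁻¹ n - x + y - z
  Q-⊛ n refl refl refl = begin
    (Q ⊛ Q⁻¹) n
      ≡⟨ ⊛-distribʳ-⊖ (one ⊖ κ ·X^ 1 ⊕ 1ℤ ·X^ 2) (1ℤ ·X^ 3) Q⁻¹ n ⟩
    ((one ⊖ κ ·X^ 1 ⊕ 1ℤ ·X^ 2) ⊛ Q⁻¹) n - z
      ≡⟨ cong (_- z) (⊛-distribʳ-⊕ (one ⊖ κ ·X^ 1) (1ℤ ·X^ 2) Q⁻¹ n) ⟩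
    ((one ⊖ κ ·X^ 1) ⊛ Q⁻¹) n + y - z
      ≡⟨ cong (λ s → s + y - z) (⊛-distribʳ-⊖ one (κ ·X^ 1) Q⁻¹ n) ⟩
    (one ⊛ Q⁻¹) n - x + y - z
      ≡⟨ cong (λ s → s - x + y - z) (one-⊛ Q⁻¹ n) ⟩
    Q⁻¹ n - x + y - z ∎
    where
    x = (κ ·X^ 1 ⊛ Q⁻¹) n
    y = (1ℤ ·X^ 2 ⊛ Q⁻¹) n
    z = (1ℤ ·X^ 3 ⊛ Q⁻¹) n

  Q-⊛-Q⁻¹ : Q ⊛ Q⁻¹ ≗ one
  -- Here and in the next two cases, `refl` marks a degree below that of the monomial, where the
  -- product computes to `0ℤ`.
  Q-⊛-Q⁻¹ 0 = Q-⊛ 0 refl refl refl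
  Q-⊛-Q⁻¹ 1 = trans (Q-⊛ 1 (·X^-⊛ κ 1 Q⁻¹ 0) refl refl) (lemma κ)
    where
    lemma : ∀ k → k - k * 1ℤ + 0ℤ - 0ℤ ≡ 0ℤ
    lemma = solve-∀
  Q-⊛-Q⁻¹ 2 =
    trans (Q-⊛ 2 (·X^-⊛ κ 1 Q⁻¹ 1) (·X^-⊛ 1ℤ 2 Q⁻¹ 0) refl) (lemma κ)
    where
    lemma : ∀ k → k * k - 1ℤ - k * k + 1ℤ * 1ℤ - 0ℤ ≡ 0ℤ
    lemma = solve-∀
  Q-⊛-Q⁻¹ (suc (suc (suc n))) =
    trans (Q-⊛ (suc (suc (suc n)))
               (·X^-⊛ κ 1 Q⁻¹ (suc (suc n))) (·X^-⊛ 1ℤ 2 Q⁻¹ (suc n)) (·X^-⊛ 1ℤ 3 Q⁻¹ n))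
          (lemma κ (Q⁻¹ (suc (suc n))) (Q⁻¹ (suc n)) (Q⁻¹ n))
    where
    lemma : ∀ k a b c → k * a - b + c - k * a + 1ℤ * b - 1ℤ * c ≡ 0ℤ
    lemma = solve-∀

  -- The recursion and three initial values determine a sequence, so it suffices that `E`, the
  -- coefficients of (1 + x²) Q⁻¹, satisfies the same recursion and has the same initial values.
  ≗-quotient : (F : Series) → F 0 ≡ 1ℤ → F 1 ≡ κ → F 2 ≡ κ * κ →
             (∀ n → F (suc (suc (suc n))) ≡ κ * F (suc (suc n)) - F (suc n) + F n) →
             F ≗ (one ⊕ 1ℤ ·X^ 2) ⊛ Q⁻¹
  ≗-quotient F F0 F1 F2 F-rec n = begin
    F n                                ≡⟨ F≡ n ⟩
    Q⁻¹ n + (1ℤ ·X^ 2 ⊛ Q⁻¹) n         ≡⟨ cong (_+ (1ℤ ·X^ 2 ⊛ Q⁻¹) n) (one-⊛ Q⁻¹ n) ⟨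
    (one ⊛ Q⁻¹) n + (1ℤ ·X^ 2 ⊛ Q⁻¹) n ≡⟨ ⊛-distribʳ-⊕ one (1ℤ ·X^ 2) Q⁻¹ n ⟨
    ((one ⊕ 1ℤ ·X^ 2) ⊛ Q⁻¹) n         ∎
    where
    E : Series
    E n = Q⁻¹ n + (1ℤ ·X^ 2 ⊛ Q⁻¹) n

    E-0 : E 0 ≡ 1ℤ
    E-0 = refl

    E-1 : E 1 ≡ κ
    E-1 = ℤ.+-identityʳ κ

    E-2+ : ∀ n → E (suc (suc n)) ≡ Q⁻¹ (suc (suc n)) + Q⁻¹ n
    E-2+ n = cong (λ y → Q⁻¹ (suc (suc n)) + y)
      (trans (·X^-⊛ 1ℤ 2 Q⁻¹ n) (ℤ.*-identityˡ (Q⁻¹ n)))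

    E-2 : E 2 ≡ κ * κ
    E-2 = trans (E-2+ 0) (lemma κ)
      where
      lemma : ∀ k → k * k - 1ℤ + 1ℤ ≡ k * k
      lemma = solve-∀

    rec : ℤ → ℤ → ℤ → ℤ
    rec a b c = κ * a - b + c

    rec-cong : ∀ {a a′ b b′ c c′} → a ≡ a′ → b ≡ b′ → c ≡ c′ →
               rec a b c ≡ rec a′ b′ c′
    rec-cong refl refl refl = refl

    E-rec : ∀ n → rec (E (suc (suc n))) (E (suc n)) (E n) ≡ E (suc (suc (suc n)))
    -- In general two instances of the recursion for `Q⁻¹`, two degrees apart, are added. The lower
    -- one is available only from `n = 2` on, so the first two cases are checked directly.
    E-rec 0 = trans (rec-cong E-2 E-1 E-0) (trans (lemma κ) (sym (E-2+ 1)))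
      where
      lemma : ∀ k → k * (k * k) - k + 1ℤ ≡ k * (k * k - 1ℤ) - k + 1ℤ + k
      lemma = solve-∀
    E-rec 1 = trans (rec-cong (E-2+ 1) (E-2+ 0) E-1) (trans (lemma κ) (sym (E-2+ 2)))
      where
      lemma : ∀ k → let q₃ = k * (k * k - 1ℤ) - k + 1ℤ in
        k * (q₃ + k) - (k * k - 1ℤ + 1ℤ) + k
          ≡ k * q₃ - (k * k - 1ℤ) + k + (k * k - 1ℤ)
      lemma = solve-∀
    E-rec (suc (suc n)) =
      trans (rec-cong (E-2+ (suc (suc n))) (E-2+ (suc n)) (E-2+ n))
            (trans (lemma κ (Q⁻¹ (suc (suc (suc (suc n))))) (Q⁻¹ (suc (suc (suc n))))
                          (Q⁻¹ (suc (suc n))) (Q⁻¹ (suc n)) (Q⁻¹ n))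
                   (sym (E-2+ (suc (suc (suc n))))))
      where
      lemma : ∀ k a b c d e →
              k * (a + c) - (b + d) + (c + e) ≡ k * a - b + c + (k * c - d + e)
      lemma = solve-∀

    F≡ : F ≗ E
    F≡ 0 = trans F0 (sym E-0)
    F≡ 1 = trans F1 (sym E-1)
    F≡ 2 = trans F2 (sym E-2)
    F≡ (suc (suc (suc n))) =
      trans (F-rec n) (trans (rec-cong (F≡ (suc (suc n))) (F≡ (suc n)) (F≡ n)) (E-rec n))

-- The alphabet has `suc k` letters: `fromℕ k` is the largest, and each other letter `inject₁ i` has
-- the successor `suc i`.
module HeadRecurrence {k} (N : ℕ → ℤ) (N-head : Fin (suc k) → ℕ → ℤ)
  (N-0 : N 0 ≡ 1ℤ)
  (N-suc : ∀ n → N (suc n) ≡ ∑[ a < suc k ] N-head a (suc n))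
  (N-head-0 : ∀ a → N-head a 0 ≡ 0ℤ)
  (N-head-1 : ∀ a → N-head a 1 ≡ N 0)
  (N-head-inject₁ : ∀ i n → N-head (inject₁ i) (suc (suc n))
                      ≡ N (suc n) - N-head (inject₁ i) n)
  (N-head-last : ∀ n → N-head (fromℕ k) (suc n) ≡ N n) where

  -- Sum the identities for all first letters. The largest letter has no subtracted term, so its
  -- count is added back to complete the sum.
  N-2+ : ∀ n → N (suc (suc n))
           ≡ + suc k * N (suc n) - ∑[ a < suc k ] N-head a n + N-head (fromℕ k) n
  N-2+ n = begin
    N (suc (suc n))
      ≡⟨ N-suc (suc n) ⟩
    ∑[ a < suc k ] N-head a (suc (suc n))
      ≡⟨ sum-init-last (λ a → N-head a (suc (suc n))) ⟩
    ∑[ i < k ] N-head (inject₁ i) (suc (suc n)) + N-head (fromℕ k) (suc (suc n))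
      ≡⟨ cong₂ _+_ (sum-cong-≗ λ i → N-head-inject₁ i n) (N-head-last (suc n)) ⟩
    ∑[ i < k ] (N (suc n) - N-head (inject₁ i) n) + N (suc n)
      ≡⟨ cong (_+ N (suc n)) (∑-const-minus k (N (suc n)) _) ⟩
    + k * N (suc n) - s + N (suc n)
      ≡⟨ lemma (+ k) (N (suc n)) s l ⟩
    + suc k * N (suc n) - (s + l) + l
      ≡⟨ cong (λ t → + suc k * N (suc n) - t + l) (sum-init-last (λ a → N-head a n)) ⟨
    + suc k * N (suc n) - ∑[ a < suc k ] N-head a n + l ∎
    where
    s = ∑[ i < k ] N-head (inject₁ i) n
    l = N-head (fromℕ k) n
    lemma : ∀ k x s l → k * x - s + x ≡ (1ℤ + k) * x - (s + l) + l
    lemma = solve-∀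

  N-1 : N 1 ≡ + suc k
  N-1 = begin
    N 1                       ≡⟨ N-suc 0 ⟩
    ∑[ a < suc k ] N-head a 1 ≡⟨ sum-cong-≗ {suc k} (λ a → trans (N-head-1 a) N-0) ⟩
    ∑[ a < suc k ] 1ℤ         ≡⟨ ∑-const (suc k) 1ℤ ⟩
    + suc k * 1ℤ              ≡⟨ ℤ.*-identityʳ (+ suc k) ⟩
    + suc k                   ∎

  N-2 : N 2 ≡ + suc k * + suc k
  N-2 = begin
    N 2
      ≡⟨ N-2+ 0 ⟩
    + suc k * N 1 - ∑[ a < suc k ] N-head a 0 + N-head (fromℕ k) 0
      ≡⟨ cong₂ _+_ (cong₂ _-_ (cong (+ suc k *_) N-1) (∑-zero (λ a → N-head a 0) N-head-0))
                   (N-head-0 (fromℕ k)) ⟩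
    + suc k * + suc k - 0ℤ + 0ℤ
      ≡⟨ lemma (+ suc k * + suc k) ⟩
    + suc k * + suc k ∎
    where
    lemma : ∀ x → x - 0ℤ + 0ℤ ≡ x
    lemma = solve-∀

  -- At positive length the sum over first letters is the full count, and the count for the largest
  -- letter is the full count one length below. At length 0 that sum is 0 instead, which is why the
  -- recursion starts at 3.
  N-3+ : ∀ n → N (suc (suc (suc n))) ≡ + suc k * N (suc (suc n)) - N (suc n) + N n
  N-3+ n = trans (N-2+ (suc n))
    (cong₂ (λ s l → + suc k * N (suc (suc n)) - s + l) (sym (N-suc n)) (N-head-last n))

module Alternating (k : ℕ) where

  R : Fin (suc k) → Fin (suc k) → Fin (suc k) → Set
  R a b c = ∃[ z ] a ≡ z × b IsSucOf z × c ≡ z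

  R? : ∀ a b c → Dec (R a b c)
  R? a b c = Fin.any? λ z → a Fin.≟ z ×-dec isSucOf? b z ×-dec c Fin.≟ z

  -- An overlap would force z = (z + 1) + 1.
  no-overlap : ∀ {a b c d} → R a b c → ¬ R b c d
  no-overlap {a} (_ , refl , p , refl) (_ , refl , q , _) =
    ℕ.m≢1+m+n (toℕ a) (trans q (cong suc (trans p (sym (ℕ.+-comm (toℕ a) 1)))))

  open Avoidance R R? no-overlap
  open Counting (λ {n} → avoids-z,z+1,z? {suc k} {n}) public

  N-head-inject₁ : ∀ i n → N-head (inject₁ i) (suc (suc n))
                     ≡ N (suc n) - N-head (inject₁ i) n
  N-head-inject₁ i = N-head-pattern (inject₁ i) (suc i) (inject₁ i) λ x y → mk⇔
    (λ { (_ , refl , p , refl) →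
           Fin.toℕ-injective (trans p (cong suc (Fin.toℕ-inject₁ i))) , refl })
    (λ { (refl , refl) → _ , refl , cong suc (sym (Fin.toℕ-inject₁ i)) , refl })

  N-head-last : ∀ n → N-head (fromℕ k) (suc n) ≡ N n
  N-head-last = N-head-free (fromℕ k) λ where
    x y (_ , refl , p , _) →
      ℕ.<⇒≢ (Fin.toℕ<n x) (trans p (cong suc (Fin.toℕ-fromℕ k)))

  open HeadRecurrence N N-head N-0 N-suc N-head-0 N-head-1 N-head-inject₁ N-head-last public

-- The pattern z, z, z+1

coefficient : ∀ m → Fin m → ℤ
coefficient m i = -1ℤ ^ toℕ i * (+ m - + toℕ i)

term : ∀ m → Fin m → Series
term m i = coefficient m i ·X^ (2 ℕ.* toℕ i ℕ.+ 1)

-- Both `m` and `i` grow by one, so their difference is unchanged and only the sign flips.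
coefficient-suc : ∀ m i → coefficient (suc m) (suc i) ≡ - coefficient m i
coefficient-suc m i = lemma (-1ℤ ^ toℕ i) (+ m) (+ toℕ i)
  where
  lemma : ∀ x m i → -1ℤ * x * ((1ℤ + m) - (1ℤ + i)) ≡ - (x * (m - i))
  lemma = solve-∀

exponent-suc : ∀ i → 2 ℕ.* suc i ℕ.+ 1 ≡ 2 ℕ.+ (2 ℕ.* i ℕ.+ 1)
exponent-suc i = cong (ℕ._+ 1) (ℕ.*-suc 2 i)

term-zero-⊛ : ∀ m H n → (term (suc m) zero ⊛ H) (suc n) ≡ + suc m * H n
term-zero-⊛ m H n =
  trans (·X^-⊛ (coefficient (suc m) zero) 1 H n) (cong (_* H n) (lemma (+ suc m)))
  where
  lemma : ∀ m → 1ℤ * (m - 0ℤ) ≡ m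
  lemma = solve-∀

-- Enlarging the alphabet by one letter and advancing the index multiplies a term by -x². This
-- matches the subtracted count two lengths below in the recursion by first letter.
term-suc-⊛ : ∀ m i H n → (term (suc m) (suc i) ⊛ H) (suc (suc n)) ≡ - (term m i ⊛ H) n
term-suc-⊛ m i H n = begin
  (term (suc m) (suc i) ⊛ H) (suc (suc n))
    ≡⟨ cong₂ (λ d e → (d ·X^ e ⊛ H) (suc (suc n)))
             (coefficient-suc m i) (exponent-suc (toℕ i)) ⟩
  ((- c) ·X^ (2 ℕ.+ e) ⊛ H) (suc (suc n)) ≡⟨ ·X^suc-⊛ (- c) (suc e) H (suc n) ⟩
  ((- c) ·X^ (1 ℕ.+ e) ⊛ H) (suc n) ≡⟨ ·X^suc-⊛ (- c) e H n ⟩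
  ((- c) ·X^ e ⊛ H) n                 ≡⟨ neg-·X^-⊛ c e H n ⟩
  - (term m i ⊛ H) n                  ∎
  where
  c = coefficient m i
  e = 2 ℕ.* toℕ i ℕ.+ 1

term-suc-⊛-1 : ∀ m i H → (term (suc m) (suc i) ⊛ H) 1 ≡ 0ℤ
term-suc-⊛-1 m i H = ·X^-⊛-< (coefficient (suc m) (suc i)) H
  (subst (1 ℕ.<_) (sym (exponent-suc (toℕ i))) (s≤s (s≤s z≤n)))

-- Induction on the alphabet: dropping the smallest letter leaves a family that
-- satisfies the same hypotheses with the same N.
∑-family-⊛ : ∀ (N : ℕ → ℤ) m (M : Fin m → ℕ → ℤ) →
  (∀ a → M a 0 ≡ 0ℤ) → (∀ a → M a 1 ≡ N 0) →
  (∀ a b → b IsSucOf a → ∀ n → M a (suc (suc n)) ≡ N (suc n) - M b n) →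
  (∀ a → suc (toℕ a) ≡ m → ∀ n → M a (suc (suc n)) ≡ N (suc n)) →
  ∀ n → ∑[ a < m ] M a n ≡ ∑[ i < m ] (term m i ⊛ N) n
∑-family-⊛ N zero    M M0 M1 Ms Ml n = refl
∑-family-⊛ N (suc m) M M0 M1 Ms Ml 0 = trans (∑-zero {suc m} (λ a → M a 0) M0)
  (sym (∑-zero {suc m} (λ i → (term (suc m) i ⊛ N) 0)
    λ i → ·X^-⊛-< (coefficient (suc m) i) N (ℕ.m≤n+m 1 (2 ℕ.* toℕ i))))
∑-family-⊛ N (suc m) M M0 M1 Ms Ml 1 = begin
  ∑[ a < suc m ] M a 1
    ≡⟨ sum-cong-≗ {suc m} M1 ⟩
  ∑[ a < suc m ] N 0
    ≡⟨ ∑-const (suc m) (N 0) ⟩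
  + suc m * N 0
    ≡⟨ ℤ.+-identityʳ (+ suc m * N 0) ⟨
  + suc m * N 0 + 0ℤ
    ≡⟨ cong₂ _+_ (term-zero-⊛ m N 0) (∑-zero {m} (λ i → (term (suc m) (suc i) ⊛ N) 1)
                                               λ i → term-suc-⊛-1 m i N) ⟨
  ∑[ i < suc m ] (term (suc m) i ⊛ N) 1 ∎
∑-family-⊛ N (suc m) M M0 M1 Ms Ml (suc (suc n)) = begin
  ∑[ a < suc m ] M a (suc (suc n))
    ≡⟨ sum-init-last (λ a → M a (suc (suc n))) ⟩
  ∑[ i < m ] M (inject₁ i) (suc (suc n)) + M (fromℕ m) (suc (suc n))
    -- The successors of all letters but the largest are exactly all letters but the smallest, so
    -- the subtracted sum runs over `M ∘ suc`.
    ≡⟨ cong₂ _+_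
         (sum-cong-≗ λ i → Ms (inject₁ i) (suc i) (cong suc (sym (Fin.toℕ-inject₁ i))) n)
         (Ml (fromℕ m) (cong suc (Fin.toℕ-fromℕ m)) n) ⟩
  ∑[ i < m ] (N (suc n) - M (suc i) n) + N (suc n)
    ≡⟨ cong (_+ N (suc n)) (∑-const-minus m (N (suc n)) (λ i → M (suc i) n)) ⟩
  + m * N (suc n) - ∑[ i < m ] M (suc i) n + N (suc n)
    ≡⟨ cong (λ s → + m * N (suc n) - s + N (suc n))
         (∑-family-⊛ N m (M ∘ suc) (M0 ∘ suc) (M1 ∘ suc)
           (λ a b p → Ms (suc a) (suc b) (cong suc p)) (λ a p → Ml (suc a) (cong suc p)) n) ⟩
  + m * N (suc n) - s + N (suc n)
    ≡⟨ lemma (+ m) (N (suc n)) s ⟩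
  + suc m * N (suc n) + (+ m * 0ℤ - s)
    -- The summand `+ m * 0ℤ` allows the negated sum to be read as a sum of differences `0ℤ - _`.
    ≡⟨ cong₂ _+_ (term-zero-⊛ m N (suc n)) (∑-const-minus m 0ℤ (λ i → (term m i ⊛ N) n)) ⟨
  (term (suc m) zero ⊛ N) (suc (suc n)) + ∑[ i < m ] (0ℤ - (term m i ⊛ N) n)
    ≡⟨ cong (λ y → (term (suc m) zero ⊛ N) (suc (suc n)) + y)
         (sum-cong-≗ {m} λ i → trans (ℤ.+-identityˡ _) (sym (term-suc-⊛ m i N n))) ⟩
  ∑[ i < suc m ] (term (suc m) i ⊛ N) (suc (suc n)) ∎
  where
  s = ∑[ i < m ] (term m i ⊛ N) n
  lemma : ∀ m x s → m * x - s + x ≡ (1ℤ + m) * x + (m * 0ℤ - s)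
  lemma = solve-∀

module Doubling (k : ℕ) where

  R : Fin k → Fin k → Fin k → Set
  R a b c = ∃[ z ] a ≡ z × b ≡ z × c IsSucOf z

  R? : ∀ a b c → Dec (R a b c)
  R? a b c = Fin.any? λ z → a Fin.≟ z ×-dec b Fin.≟ z ×-dec isSucOf? c z

  -- An overlap would force z + 1 = z.
  no-overlap : ∀ {a b c d} → R a b c → ¬ R b c d
  no-overlap (_ , refl , refl , p) (_ , refl , refl , _) = ℕ.1+n≢n (sym p)

  open Avoidance R R? no-overlap
  open Counting (λ {n} → avoids-z,z,z+1? {k} {n}) public

  N-head-isSucOf : ∀ a b → b IsSucOf a → ∀ n →
                   N-head a (suc (suc n)) ≡ N (suc n) - N-head b n
  N-head-isSucOf a b b=a+1 = N-head-pattern a a b λ x y → mk⇔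
    (λ { (_ , refl , refl , p) → refl , Fin.toℕ-injective (trans p (sym b=a+1)) })
    (λ { (refl , refl) → _ , refl , refl , b=a+1 })

  N-head-last : ∀ a → suc (toℕ a) ≡ k → ∀ n → N-head a (suc n) ≡ N n
  N-head-last a a+1=k = N-head-free a λ where
    x y (_ , refl , _ , p) → ℕ.<⇒≢ (Fin.toℕ<n y) (trans p a+1=k)

  ∑-N-head : ∀ n → ∑[ a < k ] N-head a n ≡ ∑[ i < k ] (term k i ⊛ N) n
  ∑-N-head = ∑-family-⊛ N k N-head N-head-0 N-head-1 N-head-isSucOf
    (λ a p n → N-head-last a p (suc n))

  -- Splitting by first letter requires a nonempty word. The largest exponent is 2(k - 1) + 1 = 2k -
  -- 1, so from there on no subtraction in the indices is truncated.
  N-rec : ∀ n → 1 ≤ n → 2 ℕ.* k ∸ 1 ≤ n →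
          N n ≡ ∑[ i < k ] (coefficient k i * N (n ∸ (2 ℕ.* toℕ i ℕ.+ 1)))
  N-rec (suc n) _ 2k-1≤n = trans (N-suc n) (trans (∑-N-head (suc n))
    (sum-cong-≗ {k} λ i → ·X^-⊛-≤ (coefficient k i) N (ℕ.≤-trans (bound i) 2k-1≤n)))
    where
    bound : ∀ i → 2 ℕ.* toℕ i ℕ.+ 1 ≤ 2 ℕ.* k ∸ 1
    bound i = ℕ.<⇒≤pred (subst (ℕ._≤ 2 ℕ.* k) (2*suc (toℕ i))
      (ℕ.*-monoʳ-≤ 2 (Fin.toℕ<n i)))
      where
      2*suc : ∀ i → 2 ℕ.* suc i ≡ suc (2 ℕ.* i ℕ.+ 1)
      2*suc i = trans (ℕ.*-suc 2 i) (cong suc (ℕ.+-comm 1 (2 ℕ.* i)))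

  Q : Series
  Q = one ⊖ ∑ˢ k (term k)

  -- By `∑-N-head` the product is `N` minus the sum over first letters, and that sum misses only the
  -- empty word.
  Q-⊛-N : Q ⊛ N ≗ one
  Q-⊛-N n = begin
    (Q ⊛ N) n
      ≡⟨ ⊛-distribʳ-⊖ one (∑ˢ k (term k)) N n ⟩
    (one ⊛ N) n - (∑ˢ k (term k) ⊛ N) n
      ≡⟨ cong₂ _-_ (one-⊛ N n) (⊛-distribʳ-∑ˢ k (term k) N n) ⟩
    N n - ∑[ i < k ] (term k i ⊛ N) n
      ≡⟨ cong (λ y → N n - y) (∑-N-head n) ⟨
    N n - ∑[ a < k ] N-head a n
      ≡⟨ difference n ⟩
    one n ∎
    where
    difference : ∀ n → N n - ∑[ a < k ] N-head a n ≡ one n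
    difference zero    = cong₂ _-_ N-0 (∑-zero (λ a → N-head a 0) N-head-0)
    difference (suc n) = ℤ.i≡j⇒i-j≡0 (N-suc n)

theorem9 : (k : ℕ) → 2 ≤ k →
    ( ((n : ℕ) → 3 ≤ n →
    + f k n ≡ + k * + f k (n ∸ 1) - + f k (n ∸ 2) + + f k (n ∸ 3))
    × (f k 0 ≡ 1 × f k 1 ≡ k × f k 2 ≡ k ℕ.^ 2)
    × (genFun (f k)
    ≐ (one ⊕ 1ℤ ·X^ 2)
    / (one ⊖ (+ k) ·X^ 1 ⊕ 1ℤ ·X^ 2 ⊖ 1ℤ ·X^ 3)) )
    ×
    ( ((n : ℕ) → 2 ℕ.* k ∸ 1 ≤ n →
    + g k n ≡ ∑[ i < k ]
    (-1ℤ ^ toℕ i * (+ k - + toℕ i) * + g k (n ∸ (2 ℕ.* toℕ i ℕ.+ 1))))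
    × (genFun (g k)
    ≐ one
    / (one ⊖ ∑ˢ k (λ i →
    (-1ℤ ^ toℕ i * (+ k - + toℕ i)) ·X^ (2 ℕ.* toℕ i ℕ.+ 1)))) )
theorem9 k@(suc k′) _ =
  ( (λ { _ (s≤s (s≤s (s≤s {n = n} z≤n))) → A.N-3+ n })
  , (ℤ.+-injective A.N-0 , ℤ.+-injective A.N-1 , ℤ.+-injective (trans A.N-2 k²))
  , I.Q⁻¹ , I.Q-⊛-Q⁻¹ , I.≗-quotient (genFun (f k)) A.N-0 A.N-1 A.N-2 A.N-3+ )
  ,
  ( (λ n 2k-1≤n → D.N-rec n (ℕ.≤-trans 1≤2k-1 2k-1≤n) 2k-1≤n)
  -- With numerator 1, the counting series is itself the inverse of the denominator.
  , genFun (g k) , D.Q-⊛-N , λ n → sym (one-⊛ (genFun (g k)) n) )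
  where
  module A = Alternating k′
  module D = Doubling k
  module I = RationalInverse (+ k)
  1≤2k-1 : 1 ≤ 2 ℕ.* k ∸ 1
  -- For `k = suc k′`, the bound `2 ℕ.* k ∸ 1` computes to `k′ ℕ.+ suc (k′ ℕ.+ 0)`.
  1≤2k-1 = ℕ.≤-trans (s≤s z≤n) (ℕ.m≤n+m (suc (k′ ℕ.+ 0)) k′)
  k² : + k * + k ≡ + (k ℕ.^ 2)
  k² = trans (sym (ℤ.pos-* k k)) (cong (λ j → + (k ℕ.* j)) (sym (ℕ.*-identityʳ k)))
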